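{- Let $n\ge3$ and $k\ge0$ be integers with $k<n\le 2k$. If $S$ is an independent, non-reversible set in $G_n^k$, then $$|S|\le 2+\frac{(2k+2-n)(2k+1-n)}{2}.$$
   Context: The crown $S_n^k$ is the height-2 poset on $A\cup B$, $A=\{a_1,\dots,a_{n+k}\}$ minimal elements, $B=\{b_1,\dots,b_{n+k}\}$ maximal elements, indices cyclic mod $n+k$; $a_i$ is incomparable to $b_j$ iff $j\in\{i,\dots,i+k\}$ (mod $n+k$), otherwise $a_i<b_j$. $\mathrm{Inc}(A,B)$ is the set of incomparable pairs $(a,b)\in A\times B$. $G_n^k$ is the graph on $\mathrm{Inc}(A,B)$ with $(a,b)\sim(x,y)$ iff $a<y$ and $x<b$. A set $S\subseteq\mathrm{Inc}(A,B)$ is reversible if there is a linear extension $L$ of $S_n^k$ with $x>y$ in $L$ for all $(x,y)\in S$. -}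

module Defs where

open import Data.Nat using (ℕ; _+_; _≤_; _<_)
open import Data.Fin using (Fin; toℕ)
open import Data.Sum using (_⊎_; inj₁; inj₂)
open import Data.Product using (_×_; _,_; Σ)
open import Data.Empty using (⊥)
open import Data.List using (List)
open import Data.List.Membership.Propositional using (_∈_)
open import Data.List.Relation.Unary.All using (All)
open import Relation.Nullary using (¬_)
open import Function.Definitions using (Injective)
open import Relation.Binary.PropositionalEquality using (_≡_)

-- The crown S_n^k has ground set A ∪ B with A = {a_i}, B = {b_j},
-- indices i, j ∈ Fin (n + k) (cyclic mod n + k).

-- a_i is incomparable to b_j iff j ∈ {i, i+1, ..., i+k} (mod n+k).
-- Written out without `mod`: either i ≤ j ≤ i + k, or the interval wraps
-- around, i.e. j + (n + k) ≤ i + k.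
Inc : (n k : ℕ) → Fin (n + k) → Fin (n + k) → Set
Inc n k i j = (toℕ i ≤ toℕ j × toℕ j ≤ toℕ i + k) ⊎ (toℕ j + (n + k) ≤ toℕ i + k)

-- Elements of the crown: inj₁ i = a_i (minimal), inj₂ j = b_j (maximal).
Elem : ℕ → ℕ → Set
Elem n k = Fin (n + k) ⊎ Fin (n + k)

CrownLt : (n k : ℕ) → Elem n k → Elem n k → Set
CrownLt n k (inj₁ i) (inj₂ j) = ¬ Inc n k i j
CrownLt n k (inj₁ i) (inj₁ j) = ⊥
CrownLt n k (inj₂ i) _ = ⊥

-- A linear extension of S_n^k, given by the positions of the elements in a
-- linear order: an injective position map that is strictly monotone on the
-- crown order.
IsLinearExtension : (n k : ℕ) → (Elem n k → ℕ) → Set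
IsLinearExtension n k pos =
  Injective _≡_ _≡_ pos × (∀ p q → CrownLt n k p q → pos p < pos q)

-- A pair (i , j) stands for (a_i , b_j).
Pair : ℕ → ℕ → Set
Pair n k = Fin (n + k) × Fin (n + k)

Adj : (n k : ℕ) → Pair n k → Pair n k → Set
Adj n k (i , j) (x , y) = CrownLt n k (inj₁ i) (inj₂ y) × CrownLt n k (inj₁ x) (inj₂ j)

IsVertex : (n k : ℕ) → Pair n k → Set
IsVertex n k (i , j) = Inc n k i j

Independent : (n k : ℕ) → List (Pair n k) → Set
Independent n k S = ∀ {p q} → p ∈ S → q ∈ S → ¬ Adj n k p q

Reversed : (n k : ℕ) → (Elem n k → ℕ) → Pair n k → Set
Reversed n k pos (i , j) = pos (inj₂ j) < pos (inj₁ i)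

Reversible : (n k : ℕ) → List (Pair n k) → Set
Reversible n k S =
  Σ (Elem n k → ℕ) (λ pos → IsLinearExtension n k pos × All (Reversed n k pos) S)

{-# OPTIONS --safe #-}
module Submission where

-- Read a pair (a_i , b_j) as the arc [i , j] of at most k steps on a circle with n + k points, and
-- write p → q when a_p < b_q.  Independence says that → has no 2-cycles.  If → has no 3-cycle, then
-- every path of three steps can be shortened (a chordless one would need three arcs of length k
-- through a common point, two of which miss a point on the same side), so → is acyclic and the set
-- is reversible.
--
-- Otherwise take a 3-cycle x → z → y → x.  Up to the duality (l , r) ↦ (r , l + k) and a rotation,
-- the three arcs x, y, z follow each other disjointly and y ends at k.  Then every arc [l , r] of
-- the set stays in one of three zones X, Y, Z, and any two satisfy r′ ≤ l + k or r + n ≤ l′.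
-- Removing the n - k - 1 points that separate consecutive zones leaves a circle with 2t + 3 points,
-- where t = 2k - n.  There a one-step arc [c , c + 1] excludes the antipodal point c + t + 2, so
-- the arcs with at most one step number at most 2t + 3.  Antipodal steps cannot both be covered, so
-- the coverable steps fold onto t positions, and a longer arc is determined by the two distinct
-- positions of its first and last step; there are at most t (t - 1) / 2 of those.

open import Defs
open import Data.Empty using (⊥; ⊥-elim)
open import Data.Fin using (Fin; toℕ; fromℕ<; join; splitAt)
open import Data.Fin.Properties using (any?; fromℕ<-injective; injective⇒≤; splitAt-join; toℕ<n; toℕ-injective)
open import Data.Fin.Subset using (Subset; ∣_∣) renaming (_∈_ to _∈ˢ_)
open import Data.Fin.Subset.Properties using (p⊂q⇒∣p∣<∣q∣; p⊆q⇒∣p∣≤∣q∣)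
open import Data.List using (List; []; _∷_; length; lookup)
open import Data.List.Membership.Propositional.Properties using (∈-lookup)
open import Data.List.Relation.Unary.All as All using (All)
open import Data.List.Relation.Unary.AllPairs as AllPairs using ()
open import Data.List.Relation.Unary.Any using (index)
open import Data.List.Relation.Unary.Any.Properties using (lookup-index)
open import Data.List.Relation.Unary.Unique.Propositional using (Unique)
open import Data.Nat using (ℕ; zero; suc; _+_; _*_; _∸_; _≤_; _<_; z≤n; s≤s)
open import Data.Nat.DivMod using (_/_; m*n/n≡m)
open import Data.Nat.Properties
open import Data.Nat.Tactic.RingSolver using (solve)
open import Data.Product using (_×_; _,_; Σ; ∃; ∃₂; ∃-syntax; proj₁; proj₂)
open import Data.Product.Properties using (×-≡,≡→≡)
open import Data.Sum using (_⊎_; inj₁; inj₂)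
open import Data.Sum.Properties using (inj₁-injective; inj₂-injective)
open import Data.Vec using (tabulate)
open import Data.Vec.Properties using ([]=⇒lookup; lookup⇒[]=; lookup∘tabulate)
open import Function using (_∘_)
open import Function.Definitions using (Injective)
open import Relation.Binary using (tri<; tri≈; tri>)
open import Relation.Binary.PropositionalEquality using (_≡_; refl; sym; trans; cong; cong₂; subst; module ≡-Reasoning)
open import Relation.Nullary using (¬_; Dec; yes; no; does; ¬?; _×-dec_; _⊎-dec_)
open import Relation.Nullary.Decidable using (dec-true)
open import Relation.Unary using (Decidable)

-- Linear arithmetic and a numbering of pairs.

infixr 6 _⊕_
_⊕_ : ∀ {a b c d} → a ≤ b → c ≤ d → a + c ≤ b + d
_⊕_ = +-mono-≤

-- A summand that absorbs the surplus when the other inequalities prove more than the goal.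
slack : ∀ n → 0 ≤ n
slack n = z≤n

-- Linear arithmetic: add up inequalities and compare the sum with the goal by the ring solver.
-- Sealed because the type checker would otherwise evaluate the solver's equality proofs.
abstract
  by : ∀ {a b m n} → a ≤ b → m + b ≡ n + a → m ≤ n
  by {a} {b} {m} {n} a≤b eq = +-cancelʳ-≤ b m n (≤-trans (≤-reflexive eq) (+-monoʳ-≤ n a≤b))

  absurd : ∀ {a b} {A : Set} → a ≤ b → a ≡ suc b → A
  absurd a≤b refl = ⊥-elim (1+n≰n a≤b)

-- tri n = n (n - 1) / 2; the pairs p < q < n are numbered by tri q + p.
tri : ℕ → ℕ
tri zero    = 0
tri (suc n) = n + tri n

tri-mono : ∀ {m n} → m ≤ n → tri m ≤ tri n
tri-mono z≤n       = z≤n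
tri-mono (s≤s m≤n) = m≤n ⊕ tri-mono m≤n

pair-code-< : ∀ {p q t} → p < q → q < t → tri q + p < tri t
pair-code-< {p} {q} {t} p<q q<t = ≤-trans (step p<q (tri q)) (tri-mono q<t)
  where
  step : p < q → ∀ T → suc (T + p) ≤ q + T
  step p<q T = by p<q (solve (p ∷ q ∷ T ∷ []))

pair-code-injective : ∀ {p q p′ q′} → p < q → p′ < q′ →
  tri q + p ≡ tri q′ + p′ → p ≡ p′ × q ≡ q′
pair-code-injective {p} {q} {p′} {q′} p<q p′<q′ eq with <-cmp q q′
... | tri< q<q′ _ _ = ⊥-elim (<-irrefl eq (≤-trans (pair-code-< p<q q<q′) (m≤m+n _ p′)))
... | tri≈ _ refl _ = +-cancelˡ-≡ (tri q) p p′ eq , refl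
... | tri> _ _ q′<q = ⊥-elim (<-irrefl (sym eq) (≤-trans (pair-code-< p′<q′ q′<q) (m≤m+n _ p)))

-- Counting compatible arcs on a circle with 2t + 3 points.

module Counting
  (t a β : ℕ) (a≤β : a ≤ β) (β≤t : β ≤ t)
  {m : ℕ} (l r : Fin m → ℕ)
  (l≤r : ∀ i → l i ≤ r i) (r≤ : ∀ i → r i ≤ 2 + t + t)
  (gap₁ : ∀ i → r i ≤ β ⊎ β < l i)
  (gap₂ : ∀ i → r i ≤ suc (a + t) ⊎ suc (a + t) < l i)
  -- The condition supplied by `zone-compatible`, with t + 1 and t + 2 in the roles of k and n.
  (compatible : ∀ i j → r j ≤ l i + suc t ⊎ r i + (2 + t) ≤ l j)
  (injective : ∀ i j → l i ≡ l j → r i ≡ r j → i ≡ j)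
  where

  -- Fold c p: the step from c to c + 1 sits at position p.  By gap₁ and gap₂ no arc covers the
  -- steps c = β and c = a + t + 1, which have no position.
  data Fold : ℕ → ℕ → Set where
    first  : ∀ {p} → p < β → Fold p p
    second : ∀ {p} → β ≤ p → p < t → Fold (suc p) p
    third  : ∀ {p} → p < a → Fold (p + suc t) p
    fourth : ∀ {p} → a ≤ p → p < t → Fold (p + (2 + t)) p

  Fold-< : ∀ {c p} → Fold c p → p < t
  Fold-< (first p<β)    = ≤-trans p<β β≤t
  Fold-< (second _ p<t) = p<t
  Fold-< (third p<a)    = ≤-trans p<a (≤-trans a≤β β≤t)
  Fold-< (fourth _ p<t) = p<t

  -- The first alternative of `compatible` puts d below c + t + 1, the second puts it above c + t +
  -- 2.
  antipodal : ∀ i j {c d} → l i ≤ c → c < r i → l j ≤ d → d < r j →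
    c + suc t ≤ d → d ≤ c + (2 + t) → ⊥
  antipodal i j {c} {d} li≤c c<ri lj≤d d<rj c≤d d≤c =
    go (l i) (r i) (l j) (r j) li≤c c<ri lj≤d d<rj (compatible i j)
    where
    go : ∀ l r l′ r′ → l ≤ c → c < r → l′ ≤ d → d < r′ →
      r′ ≤ l + suc t ⊎ r + (2 + t) ≤ l′ → ⊥
    go l r l′ r′ l≤c c<r l′≤d d<r′ (inj₁ r′≤l) =
      absurd (r′≤l ⊕ l≤c ⊕ d<r′ ⊕ c≤d) (solve (l ∷ c ∷ d ∷ r′ ∷ t ∷ []))
    go l r l′ r′ l≤c c<r l′≤d d<r′ (inj₂ r≤l′) =
      absurd (r≤l′ ⊕ c<r ⊕ l′≤d ⊕ d≤c) (solve (r ∷ c ∷ d ∷ l′ ∷ t ∷ []))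

  near : ∀ p → p + suc t ≤ p + (2 + t)
  near p = +-monoʳ-≤ p (n≤1+n _)

  -- Distinct steps with a common position are t + 1 or t + 2 apart, so `antipodal` forbids covering
  -- both. Positions of `second` and `third` steps never agree, because a ≤ β.
  Fold-injective : ∀ i j {c d p} → l i ≤ c → c < r i → l j ≤ d → d < r j →
    Fold c p → Fold d p → c ≡ d
  Fold-injective i j li≤c c<ri lj≤d d<rj = λ where
    (first _)    (first _)    → refl
    (first p<β)  (second β≤p _) → ⊥-elim (<⇒≱ p<β β≤p)
    (first _)    (third _)    → ⊥-elim (antipodal i j li≤c c<ri lj≤d d<rj ≤-refl (near _))
    (first _)    (fourth _ _) → ⊥-elim (antipodal i j li≤c c<ri lj≤d d<rj (near _) ≤-refl)
    (second β≤p _) (first p<β)  → ⊥-elim (<⇒≱ p<β β≤p)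
    (second _ _)   (second _ _) → refl
    (second β≤p _) (third p<a)  → ⊥-elim (<⇒≱ p<a (≤-trans a≤β β≤p))
    (second _ _) (fourth {p} _ _) → ⊥-elim (antipodal i j li≤c c<ri lj≤d d<rj
      (≤-reflexive (sym (+-suc p (suc t)))) (n≤1+n _))
    (third _)    (first _)    → ⊥-elim (antipodal j i lj≤d d<rj li≤c c<ri ≤-refl (near _))
    (third p<a)  (second β≤p _) → ⊥-elim (<⇒≱ p<a (≤-trans a≤β β≤p))
    (third _)    (third _)    → refl
    (third p<a)  (fourth a≤p _) → ⊥-elim (<⇒≱ p<a a≤p)
    (fourth _ _) (first _)    → ⊥-elim (antipodal j i lj≤d d<rj li≤c c<ri (near _) ≤-refl)
    (fourth {p} _ _) (second _ _) → ⊥-elim (antipodal j i lj≤d d<rj li≤c c<ri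
      (≤-reflexive (sym (+-suc p (suc t)))) (n≤1+n _))
    (fourth a≤p _) (third p<a)  → ⊥-elim (<⇒≱ p<a a≤p)
    (fourth _ _) (fourth _ _) → refl

  fold : ∀ i {c} → l i ≤ c → c < r i → ∃ (Fold c)
  fold i {c} li≤c c<ri with <-cmp c β
  ... | tri< c<β _ _ = c , first c<β
  ... | tri≈ _ refl _ with gap₁ i
  ...   | inj₁ ri≤β = ⊥-elim (<⇒≱ c<ri ri≤β)
  ...   | inj₂ β<li = ⊥-elim (<⇒≱ β<li li≤c)
  fold i {c} li≤c c<ri | tri> _ _ β<c with c ≤? t
  fold i {suc p} li≤c c<ri | tri> _ _ (s≤s β≤p) | yes c≤t = p , second β≤p c≤t
  fold i {c} li≤c c<ri | tri> _ _ β<c | no c≰t with m≤n⇒∃[o]m+o≡n (≰⇒> c≰t)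
  ... | p , refl with <-cmp p a
  ...   | tri< p<a _ _ = p , subst (λ c → Fold c p) (+-comm p (suc t)) (third p<a)
  ...   | tri≈ _ refl _ with gap₂ i
  ...     | inj₁ ri≤ = ⊥-elim (<⇒≱ c<ri (≤-trans ri≤ (≤-reflexive (cong suc (+-comm p t)))))
  ...     | inj₂ <li = ⊥-elim (<⇒≱ <li (≤-trans li≤c (≤-reflexive (cong suc (+-comm t p)))))
  fold i li≤c c<ri | tri> _ _ β<c | no c≰t | suc p , refl | tri> _ _ (s≤s a≤p) =
    p , subst (λ c → Fold c p) shift (fourth a≤p
      (by (≤-trans c<ri (r≤ i)) (solve (p ∷ t ∷ []))))
    where
    shift : p + (2 + t) ≡ suc t + suc p
    shift = solve (p ∷ t ∷ [])

  -- A one-step arc is charged to its antipodal point.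
  data Short (i : Fin m) : ℕ → Set where
    point : r i ≡ l i → Short i (l i)
    low   : r i ≡ suc (l i) → Short i (l i + (2 + t))
    high  : ∀ {c} → l i ≡ c + suc t → r i ≡ suc (l i) → Short i c

  -- Folding does not preserve the order along the arc, so either the first or the last step may
  -- have the smaller position.
  Long : Fin m → ℕ → ℕ → Set
  Long i p q = ∃[ d ] r i ≡ suc d × l i < d ×
    (Fold (l i) p × Fold d q ⊎ Fold (l i) q × Fold d p)

  Code : Fin m → Set
  Code i = (∃[ c ] c < 3 + t + t × Short i c) ⊎ (∃₂ λ p q → p < q × q < t × Long i p q)

  code : ∀ i → Code i
  code i with m≤n⇒∃[o]m+o≡n (l≤r i)
  ... | zero , eq =
      inj₁ (l i , s≤s (≤-trans (l≤r i) (r≤ i)) , point (trans (sym eq) (+-identityʳ _)))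
  -- The antipodal point l + t + 2 is reduced modulo 2t + 3: for l ≤ t it stays, beyond that it
  -- becomes l - (t + 1).
  ... | suc zero , eq with l i ≤? t
  ...   | yes li≤t = inj₁ (l i + (2 + t) , lt (l i) li≤t , low (trans (sym eq) (+-comm _ 1)))
    where
    lt : ∀ l → l ≤ t → l + (2 + t) < 3 + t + t
    lt l l≤t = by l≤t (solve (l ∷ t ∷ []))
  ...   | no li≰t with m≤n⇒∃[o]m+o≡n (≰⇒> li≰t)
  ...     | c , eq′ = inj₁ (c ,
            by (≤-trans (≤-trans (≤-reflexive eq′) (l≤r i)) (r≤ i) ⊕ slack (1 + t))
                (solve (c ∷ t ∷ [])) ,
            high (trans (sym eq′) (+-comm (suc t) c)) (trans (sym eq) (+-comm _ 1)))
  code i | suc (suc o) , eq with fold i ≤-refl l<r | fold i l≤d d<r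
    where
    l<r : l i < r i
    l<r = ≤-trans (m<m+n (l i) (s≤s z≤n)) (≤-reflexive eq)
    l≤d : l i ≤ l i + suc o
    l≤d = m≤m+n _ _
    d<r : l i + suc o < r i
    d<r = ≤-reflexive (trans (sym (+-suc (l i) (suc o))) eq)
  ... | p , fl | q , fd = ordered (<-cmp p q)
    where
    r≡ : r i ≡ suc (l i + suc o)
    r≡ = trans (sym eq) (+-suc (l i) (suc o))
    l<d : l i < l i + suc o
    l<d = m<m+n (l i) (s≤s z≤n)
    ordered : _ → Code i
    ordered (tri< p<q _ _) = inj₂ (p , q , p<q , Fold-< fd , _ , r≡ , l<d , inj₁ (fl , fd))
    ordered (tri> _ _ q<p) = inj₂ (q , p , q<p , Fold-< fl , _ , r≡ , l<d , inj₂ (fl , fd))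
    -- `Fold-injective` for the arc and itself: equal positions would make its first and last step
    -- coincide.
    ordered (tri≈ _ refl _) = ⊥-elim (<-irrefl
      (Fold-injective i i ≤-refl (≤-trans l<d (≤-trans (n≤1+n _) (≤-reflexive (sym r≡))))
        (<⇒≤ l<d) (≤-reflexive (sym r≡)) fl fd) l<d)

  -- A one-step arc and the point antipodal to it miss both alternatives of `compatible` by one.
  point≢low : ∀ {i j} → r i ≡ l i → r j ≡ suc (l j) → l i ≡ l j + (2 + t) → ⊥
  point≢low {i} {j} = go (l i) (l j) (r i) (r j) (compatible j i)
    where
    go : ∀ l l′ r r′ → r ≤ l′ + suc t ⊎ r′ + (2 + t) ≤ l →
      r ≡ l → r′ ≡ suc l′ → l ≡ l′ + (2 + t) → ⊥
    go l l′ r r′ (inj₁ r≤) refl refl refl = absurd r≤ (solve (l′ ∷ t ∷ []))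
    go l l′ r r′ (inj₂ ≤l) refl refl refl = absurd ≤l refl

  point≢high : ∀ {i j} → r i ≡ l i → r j ≡ suc (l j) → l j ≡ l i + suc t → ⊥
  point≢high {i} {j} = go (l i) (l j) (r i) (r j) (compatible i j)
    where
    go : ∀ l l′ r r′ → r′ ≤ l + suc t ⊎ r + (2 + t) ≤ l′ →
      r ≡ l → r′ ≡ suc l′ → l′ ≡ l + suc t → ⊥
    go l l′ r r′ (inj₁ r≤) refl refl refl = absurd r≤ refl
    go l l′ r r′ (inj₂ ≤l) refl refl refl = absurd ≤l (solve (l ∷ t ∷ []))

  low≢high : ∀ {i j c} → l j ≡ c + suc t → r j ≡ suc (l j) → c ≡ l i + (2 + t) → ⊥
  low≢high {i} {j} = go (l i) (l j) (r j) (r≤ j)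
    where
    go : ∀ {c} l l′ r′ → r′ ≤ 2 + t + t → l′ ≡ c + suc t → r′ ≡ suc l′ → c ≡ l + (2 + t) → ⊥
    go l l′ r′ r′≤ refl refl refl = absurd (r′≤ ⊕ slack (suc l)) (solve (l ∷ t ∷ []))

  Short-injective : ∀ {i j c d} → c ≡ d → Short i c → Short j d → i ≡ j
  Short-injective c≡d (point e) (point e′)   = injective _ _ c≡d (trans e (trans c≡d (sym e′)))
  Short-injective c≡d (point e) (low e′)     = ⊥-elim (point≢low e e′ c≡d)
  Short-injective refl (point e) (high e′ e″) = ⊥-elim (point≢high e e″ e′)
  Short-injective c≡d (low e) (point e′)     = ⊥-elim (point≢low e′ e (sym c≡d))
  Short-injective {i} {j} c≡d (low e) (low e′) =
      injective _ _ li≡lj (trans e (trans (cong suc li≡lj) (sym e′)))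
    where
    li≡lj : l i ≡ l j
    li≡lj = +-cancelʳ-≡ (2 + t) (l i) (l j) c≡d
  Short-injective c≡d (low e) (high e′ e″) = ⊥-elim (low≢high e′ e″ (sym c≡d))
  Short-injective refl (high e e′) (point e″) = ⊥-elim (point≢high e″ e′ e)
  Short-injective c≡d (high e e′) (low e″) = ⊥-elim (low≢high e e′ c≡d)
  Short-injective {i} {j} refl (high e e₁) (high e′ e₂) =
      injective _ _ li≡lj (trans e₁ (trans (cong suc li≡lj) (sym e₂)))
    where
    li≡lj : l i ≡ l j
    li≡lj = trans e (sym e′)

  Long-injective : ∀ {i j p q} → Long i p q → Long j p q → i ≡ j
  Long-injective {i} {j} (d , ri≡ , li<d , f) (d′ , rj≡ , lj<d′ , g) = go f g
    where
    d<ri : d < r i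
    d<ri = ≤-reflexive (sym ri≡)
    li<ri : l i < r i
    li<ri = ≤-trans li<d (<⇒≤ d<ri)
    d′<rj : d′ < r j
    d′<rj = ≤-reflexive (sym rj≡)
    lj<rj : l j < r j
    lj<rj = ≤-trans lj<d′ (<⇒≤ d′<rj)

    same : ∀ {p q} → Fold (l i) p → Fold d q → Fold (l j) p → Fold d′ q → i ≡ j
    same fl fd fl′ fd′ = injective _ _
      (Fold-injective i j ≤-refl li<ri ≤-refl lj<rj fl fl′)
      (trans ri≡ (trans (cong suc (Fold-injective i j (<⇒≤ li<d) d<ri (<⇒≤ lj<d′) d′<rj fd fd′)) (sym rj≡)))

    -- The first step of each arc would be the last step of the other, so each would start before
    -- the other.
    crossed : ∀ {p q} → Fold (l i) p → Fold d q → Fold (l j) q → Fold d′ p → i ≡ j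
    crossed fl fd fl′ fd′
      with Fold-injective i j ≤-refl li<ri (<⇒≤ lj<d′) d′<rj fl fd′
         | Fold-injective i j (<⇒≤ li<d) d<ri ≤-refl lj<rj fd fl′
    ... | li≡d′ | d≡lj =
        ⊥-elim (<-asym li<d (≤-trans (≤-reflexive (cong suc d≡lj)) (≤-trans lj<d′ (≤-reflexive (sym li≡d′)))))

    go : ∀ {p q} → Fold (l i) p × Fold d q ⊎ Fold (l i) q × Fold d p →
      Fold (l j) p × Fold d′ q ⊎ Fold (l j) q × Fold d′ p → i ≡ j
    go (inj₁ (fl , fd)) (inj₁ (fl′ , fd′)) = same fl fd fl′ fd′
    go (inj₁ (fl , fd)) (inj₂ (fl′ , fd′)) = crossed fl fd fl′ fd′
    go (inj₂ (fl , fd)) (inj₁ (fl′ , fd′)) = crossed fl fd fl′ fd′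
    go (inj₂ (fl , fd)) (inj₂ (fl′ , fd′)) = same fl fd fl′ fd′

  slot : ∀ {i} → Code i → Fin (3 + t + t) ⊎ Fin (tri t)
  slot (inj₁ (_ , c< , _))            = inj₁ (fromℕ< c<)
  slot (inj₂ (_ , _ , p<q , q<t , _)) = inj₂ (fromℕ< (pair-code-< p<q q<t))

  slot-injective : ∀ {i j} (x : Code i) (y : Code j) → slot x ≡ slot y → i ≡ j
  slot-injective (inj₁ (c , c< , s)) (inj₁ (d , d< , s′)) eq =
    Short-injective (fromℕ<-injective c d c< d< (inj₁-injective eq)) s s′
  slot-injective (inj₂ (_ , _ , p<q , q<t , s)) (inj₂ (_ , _ , p′<q′ , q′<t , s′)) eq
    with pair-code-injective p<q p′<q′
      (fromℕ<-injective _ _ (pair-code-< p<q q<t) (pair-code-< p′<q′ q′<t) (inj₂-injective eq))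
  ... | refl , refl = Long-injective s s′

  bound : m ≤ (3 + t + t) + tri t
  bound = injective⇒≤ {f = λ i → join _ _ (slot (code i))}
    (λ eq → slot-injective (code _) (code _) (join-injective eq))
    where
    join-injective : ∀ {x y} → join (3 + t + t) (tri t) x ≡ join (3 + t + t) (tri t) y → x ≡ y
    join-injective {x} {y} eq =
        trans (sym (splitAt-join _ _ x)) (trans (cong (splitAt _) eq) (splitAt-join _ _ y))

-- Zones, and the removal of the points between them.

-- Here a and b are the right ends of the arcs x and z of the 3-cycle.
data Zone (n k a b l r : ℕ) : Set where
  X : r + n ≤ b → Zone n k a b l r
  Y : b ≤ l + k → r ≤ a + k → Zone n k a b l r
  Z : a + n ≤ l → r ≤ k + k → Zone n k a b l r

-- Here k is `suc (e + t)`, n is `suc (suc (e + t) + e)` and b is n + β, so e = n - k - 1 and t = 2k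
-- - n. The zones become the intervals [0 , β], [β + e + 1 , a + e + t + 1] and
-- [a + 2e + t + 2 , 2k].
module Compression (e t a β : ℕ) (a≤β : a ≤ β) (β≤t : β ≤ t) where

  -- Squeeze x x′: the point x of some zone is the point x′ after the e points before zone Y and
  -- the e points before zone Z have been removed.
  data Squeeze : ℕ → ℕ → Set where
    X : ∀ {x} → x ≤ β → Squeeze x x
    Y : ∀ {x} → β < x → x ≤ suc (a + t) → Squeeze (x + e) x
    Z : ∀ {x} → suc (a + t) < x → x ≤ 2 + t + t → Squeeze (x + (e + e)) x

  -- If y lies in a later zone than x, at least e points between them disappear; otherwise the zones
  -- are short enough.
  squeeze-≤ : ∀ {x x′ y y′} → Squeeze x x′ → Squeeze y y′ → y ≤ x + suc (e + t) → y′ ≤ x′ + suc t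
  squeeze-≤ {x} {x′} {y} {y′} _ (X y≤β) _ =
    by (y≤β ⊕ β≤t ⊕ slack (suc x′)) (solve (x′ ∷ y ∷ β ∷ t ∷ []))
  squeeze-≤ {x} {.x} {_} {y′} (X _) (Y _ _) le = by le (solve (x ∷ y′ ∷ e ∷ t ∷ []))
  squeeze-≤ {_} {x′} {_} {y′} (Y β<x _) (Y _ y≤) _ =
    by (y≤ ⊕ a≤β ⊕ β<x ⊕ slack 1) (solve (x′ ∷ y′ ∷ a ∷ β ∷ t ∷ []))
  squeeze-≤ {_} {x′} {_} {y′} (Z <x _) (Y _ y≤) _ =
    by (y≤ ⊕ <x ⊕ slack (2 + t)) (solve (x′ ∷ y′ ∷ a ∷ t ∷ []))
  squeeze-≤ {x} {.x} {_} {y′} (X _) (Z _ _) le =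
    by (le ⊕ slack e) (solve (x ∷ y′ ∷ e ∷ t ∷ []))
  squeeze-≤ {_} {x′} {_} {y′} (Y _ _) (Z _ _) le = by le (solve (x′ ∷ y′ ∷ e ∷ t ∷ []))
  squeeze-≤ {_} {x′} {_} {y′} (Z <x _) (Z _ y≤) _ =
    by (y≤ ⊕ <x ⊕ slack (1 + a)) (solve (x′ ∷ y′ ∷ a ∷ t ∷ []))

  -- A distance of n = 2e + t + 2 forces y into a later zone, and at most 2e points between them
  -- disappear.
  squeeze-≥ : ∀ {x x′ y y′} → Squeeze x x′ → Squeeze y y′ →
    x + suc (suc (e + t) + e) ≤ y → x′ + (2 + t) ≤ y′
  squeeze-≥ {x} {x′} {y} {y′} _ (X y≤β) le =
    absurd (le ⊕ y≤β ⊕ β≤t ⊕ slack (x + e + e + 1)) (solve (x ∷ y ∷ β ∷ e ∷ t ∷ []))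
  squeeze-≥ {x} {.x} {_} {y′} (X _) (Y _ _) le =
    by (le ⊕ slack e) (solve (x ∷ y′ ∷ e ∷ t ∷ []))
  squeeze-≥ {_} {x′} {_} {y′} (Y β<x _) (Y _ y≤) le =
    absurd (le ⊕ y≤ ⊕ a≤β ⊕ β<x ⊕ slack (1 + e + e)) (solve (x′ ∷ y′ ∷ a ∷ β ∷ e ∷ t ∷ []))
  squeeze-≥ {_} {x′} {_} {y′} (Z <x _) (Y _ y≤) le =
    absurd (le ⊕ y≤ ⊕ <x ⊕ slack (2 + e + e + e + t)) (solve (x′ ∷ y′ ∷ a ∷ e ∷ t ∷ []))
  squeeze-≥ {x} {.x} {_} {y′} (X _) (Z _ _) le = by le (solve (x ∷ y′ ∷ e ∷ t ∷ []))
  squeeze-≥ {_} {x′} {_} {y′} (Y _ _) (Z _ _) le =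
    by (le ⊕ slack e) (solve (x′ ∷ y′ ∷ e ∷ t ∷ []))
  squeeze-≥ {_} {x′} {_} {y′} (Z <x _) (Z _ y≤) le =
    absurd (le ⊕ y≤ ⊕ <x ⊕ slack (1 + a + e + e)) (solve (x′ ∷ y′ ∷ a ∷ e ∷ t ∷ []))

  X∩Z : ∀ {z} → z ≤ β → suc (a + t) < z → ⊥
  X∩Z {z} ≤β <z = absurd (≤β ⊕ β≤t ⊕ <z ⊕ slack (1 + a)) (solve (a ∷ β ∷ t ∷ z ∷ []))

  squeeze-injective : ∀ {x y z} → Squeeze x z → Squeeze y z → x ≡ y
  squeeze-injective (X _)   (X _)    = refl
  squeeze-injective (X ≤β)  (Y β< _) = ⊥-elim (<⇒≱ β< ≤β)
  squeeze-injective (X ≤β) (Z <z _) = ⊥-elim (X∩Z ≤β <z)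
  squeeze-injective (Y β< _) (X ≤β)  = ⊥-elim (<⇒≱ β< ≤β)
  squeeze-injective (Y _ _) (Y _ _)  = refl
  squeeze-injective (Y _ ≤z) (Z <z _) = ⊥-elim (<⇒≱ <z ≤z)
  squeeze-injective (Z <z _) (X ≤β) = ⊥-elim (X∩Z ≤β <z)
  squeeze-injective (Z <z _) (Y _ ≤z) = ⊥-elim (<⇒≱ <z ≤z)
  squeeze-injective (Z _ _) (Z _ _)  = refl

  record Squeezed (l r : ℕ) : Set where
    field
      {l′ r′} : ℕ
      left  : Squeeze l l′
      right : Squeeze r r′
      l′≤r′ : l′ ≤ r′
      r′≤   : r′ ≤ 2 + t + t
      gap₁  : r′ ≤ β ⊎ β < l′
      gap₂  : r′ ≤ suc (a + t) ⊎ suc (a + t) < l′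

  squeeze : ∀ {l r} → l ≤ r →
    Zone (suc (suc (e + t) + e)) (suc (e + t)) a (suc (suc (e + t) + e) + β) l r → Squeezed l r
  squeeze {l} {r} l≤r (X r≤) = record
    { left = X (≤-trans l≤r r≤β) ; right = X r≤β ; l′≤r′ = l≤r
    ; r′≤ = by (r≤β ⊕ β≤t ⊕ slack (2 + t)) (solve (r ∷ β ∷ t ∷ []))
    ; gap₁ = inj₁ r≤β
    ; gap₂ = inj₁ (by (r≤β ⊕ β≤t ⊕ slack (1 + a)) (solve (a ∷ r ∷ β ∷ t ∷ []))) }
    where
    r≤β : r ≤ β
    r≤β =
        +-cancelʳ-≤ (suc (suc (e + t) + e)) r β (≤-trans r≤ (≤-reflexive (+-comm (suc (suc (e + t) + e)) β)))
  squeeze {l} {r} l≤r (Y l≥ r≤) with m≤n⇒∃[o]m+o≡n e≤l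
    where
    e≤l : e ≤ l
    e≤l = by (l≥ ⊕ slack (suc β)) (solve (l ∷ e ∷ β ∷ t ∷ []))
  squeeze {l} {r} l≤r (Y l≥ r≤) | l′ , refl with m≤n⇒∃[o]m+o≡n (≤-trans (m≤m+n e l′) l≤r)
  ... | r′ , refl = record
    { left = subst (λ x → Squeeze x l′) (+-comm l′ e) (Y β<l′ (≤-trans l′≤r′ r′≤))
    ; right = subst (λ x → Squeeze x r′) (+-comm r′ e) (Y (≤-trans β<l′ l′≤r′) r′≤)
    ; l′≤r′ = l′≤r′
    ; r′≤ = by (r′≤ ⊕ a≤β ⊕ β≤t ⊕ slack 1) (solve (a ∷ β ∷ r′ ∷ t ∷ []))
    ; gap₁ = inj₂ β<l′ ; gap₂ = inj₁ r′≤ }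
    where
    l′≤r′ : l′ ≤ r′
    l′≤r′ = +-cancelˡ-≤ e l′ r′ l≤r
    β<l′ : β < l′
    β<l′ = by l≥ (solve (l′ ∷ e ∷ β ∷ t ∷ []))
    r′≤ : r′ ≤ suc (a + t)
    r′≤ = by r≤ (solve (a ∷ r′ ∷ e ∷ t ∷ []))
  squeeze {l} {r} l≤r (Z l≥ r≤) with m≤n⇒∃[o]m+o≡n e≤l
    where
    e≤l : e + e ≤ l
    e≤l = by (l≥ ⊕ slack (2 + a + t)) (solve (a ∷ l ∷ e ∷ t ∷ []))
  squeeze {l} {r} l≤r (Z l≥ r≤) | l′ , refl with m≤n⇒∃[o]m+o≡n (≤-trans (m≤m+n (e + e) l′) l≤r)
  ... | r′ , refl = record
    { left = subst (λ x → Squeeze x l′) (+-comm l′ (e + e)) (Z <l′ (≤-trans l′≤r′ r′≤))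
    ; right = subst (λ x → Squeeze x r′) (+-comm r′ (e + e)) (Z (≤-trans <l′ l′≤r′) r′≤)
    ; l′≤r′ = l′≤r′
    ; r′≤ = r′≤
    ; gap₁ = inj₂ (by (<l′ ⊕ β≤t ⊕ slack (1 + a)) (solve (a ∷ β ∷ t ∷ l′ ∷ [])))
    ; gap₂ = inj₂ <l′ }
    where
    l′≤r′ : l′ ≤ r′
    l′≤r′ = +-cancelˡ-≤ (e + e) l′ r′ l≤r
    <l′ : suc (a + t) < l′
    <l′ = by l≥ (solve (l′ ∷ e ∷ a ∷ t ∷ []))
    r′≤ : r′ ≤ 2 + t + t
    r′≤ = by r≤ (solve (r′ ∷ e ∷ t ∷ []))

  module _ {m : ℕ} (l r : Fin m → ℕ) (l≤r : ∀ i → l i ≤ r i)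
    (zone : ∀ i → Zone (suc (suc (e + t) + e)) (suc (e + t)) a (suc (suc (e + t) + e) + β) (l i) (r i))
    (compatible : ∀ i j → r j ≤ l i + suc (e + t) ⊎ r i + suc (suc (e + t) + e) ≤ l j)
    (injective : ∀ i j → l i ≡ l j → r i ≡ r j → i ≡ j)
    where

    private
      squeezed : ∀ i → Squeezed (l i) (r i)
      squeezed i = squeeze (l≤r i) (zone i)

      module S i = Squeezed (squeezed i)

      compatible′ : ∀ i j → S.r′ j ≤ S.l′ i + suc t ⊎ S.r′ i + (2 + t) ≤ S.l′ j
      compatible′ i j with compatible i j
      ... | inj₁ le = inj₁ (squeeze-≤ (S.left i) (S.right j) le)
      ... | inj₂ le = inj₂ (squeeze-≥ (S.right i) (S.left j) le)

      injective′ : ∀ i j → S.l′ i ≡ S.l′ j → S.r′ i ≡ S.r′ j → i ≡ j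
      injective′ i j l≡ r≡ = injective i j
        (squeeze-injective (subst (Squeeze (l i)) l≡ (S.left i)) (S.left j))
        (squeeze-injective (subst (Squeeze (r i)) r≡ (S.right i)) (S.right j))

    zones-bound : m ≤ (3 + t + t) + tri t
    zones-bound =
        Counting.bound t a β a≤β β≤t S.l′ S.r′ S.l′≤r′ S.r′≤ S.gap₁ S.gap₂ compatible′ injective′

-- Arcs on the circle, rotations and duality.

-- On the circle with n + k points, j lies on the arc of k steps that starts at i.
data Arc (n k i j : ℕ) : Set where
  ahead : i ≤ j → j ≤ i + k → Arc n k i j
  wrap  : j + n ≤ i → Arc n k i j

arc? : ∀ n k i j → Dec (Arc n k i j)
arc? n k i j with i ≤? j | j ≤? i + k | j + n ≤? i
... | yes p | yes q | _     = yes (ahead p q)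
... | _     | _     | yes r = yes (wrap r)
... | no ¬p | _     | no ¬r = no λ { (ahead p _) → ¬p p ; (wrap r) → ¬r r }
... | _     | no ¬q | no ¬r = no λ { (ahead _ q) → ¬q q ; (wrap r) → ¬r r }

-- y is x + s modulo N, for x, y < N and s ≤ N.
data Turn (N s x y : ℕ) : Set where
  straight : y ≡ x + s → Turn N s x y
  around   : y + N ≡ x + s → Turn N s x y

turn-inverse : ∀ {N s s′ x y} → s + s′ ≡ N → Turn N s x y → Turn N s′ y x
turn-inverse {_} {s} {s′} {x} refl (straight refl) = around (sym (+-assoc x s s′))
turn-inverse {_} {s} {s′} {x} {y} refl (around eq) =
    straight (+-cancelʳ-≡ s x (y + s′) (trans (sym eq) (shuffle y)))
  where
  shuffle : ∀ y → y + (s + s′) ≡ y + s′ + s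
  shuffle y = solve (y ∷ s ∷ s′ ∷ [])

turn-functional : ∀ {N s x y y′} → y < N → y′ < N → Turn N s x y → Turn N s x y′ → y ≡ y′
turn-functional y< y′< (straight e) (straight e′) = trans e (sym e′)
turn-functional {N} {y′ = y′} y< y′< (straight e) (around e′) =
  ⊥-elim (<⇒≱ y< (≤-trans (m≤n+m N y′) (≤-reflexive (trans e′ (sym e)))))
turn-functional {N} {y = y} y< y′< (around e) (straight e′) =
  ⊥-elim (<⇒≱ y′< (≤-trans (m≤n+m N y) (≤-reflexive (trans e (sym e′)))))
turn-functional {N} {y =
    y} {y′} y< y′< (around e) (around e′) = +-cancelʳ-≡ N y y′ (trans e (sym e′))

turn : ℕ → ℕ → ℕ → ℕ
turn N s x with x + s <? N
... | yes _ = x + s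
... | no  _ = x + s ∸ N

turn-spec : ∀ {N s x} → Turn N s x (turn N s x)
turn-spec {N} {s} {x} with x + s <? N
... | yes _ = straight refl
... | no ≮N = around (m∸n+n≡m (≮⇒≥ ≮N))

turn-< : ∀ {N s x} → s ≤ N → x < N → turn N s x < N
turn-< {N} {s} {x} s≤N x<N with x + s <? N
... | yes <N = <N
... | no ≮N = +-cancelʳ-< N _ N (≤-trans (s≤s (≤-reflexive (m∸n+n≡m (≮⇒≥ ≮N)))) (+-mono-≤ x<N s≤N))

module _ {n k : ℕ} where

  -- If both ends or neither pass the origin, the form of the arc is kept. If only one does, `ahead`
  -- and `wrap` turn into each other or a coordinate leaves the range.
  arc-turn : ∀ {s i j i′ j′} → i < n + k → i′ < n + k → j′ < n + k →
    Turn (n + k) s i i′ → Turn (n + k) s j j′ → Arc n k i j → Arc n k i′ j′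
  arc-turn {s} {i} {j} {i′} {j′} i< i′< j′< = go
    where
    straight-straight : ∀ {i′ j′} → i′ ≡ i + s → j′ ≡ j + s → Arc n k i j → Arc n k i′ j′
    straight-straight refl refl (ahead p q) = ahead (+-monoˡ-≤ s p) (by q
        (solve (i ∷ j ∷ k ∷ s ∷ [])))
    straight-straight refl refl (wrap p) = wrap (by p (solve (i ∷ j ∷ n ∷ s ∷ [])))

    around-around : i′ + (n + k) ≡ i + s → j′ + (n + k) ≡ j + s → Arc n k i j → Arc n k i′ j′
    around-around e f (ahead p q) = ahead
      (by (p ⊕ ≤-reflexive e ⊕ ≤-reflexive (sym f)) (solve (i ∷ j ∷ i′ ∷ j′ ∷ n ∷ k ∷ s ∷ [])))
      (by (q ⊕ ≤-reflexive f ⊕ ≤-reflexive (sym e)) (solve (i ∷ j ∷ i′ ∷ j′ ∷ n ∷ k ∷ s ∷ [])))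
    around-around e f (wrap p) = wrap
      (by (p ⊕ ≤-reflexive f ⊕ ≤-reflexive (sym e)) (solve (i ∷ j ∷ i′ ∷ j′ ∷ n ∷ k ∷ s ∷ [])))

    straight-around : i′ ≡ i + s → j′ + (n + k) ≡ j + s → Arc n k i j → Arc n k i′ j′
    straight-around e f (ahead p q) = wrap
      (by (q ⊕ ≤-reflexive f ⊕ ≤-reflexive (sym e)) (solve (i ∷ j ∷ i′ ∷ j′ ∷ n ∷ k ∷ s ∷ [])))
    straight-around e f (wrap p) =
      absurd (p ⊕ ≤-reflexive f ⊕ ≤-reflexive (sym e) ⊕ i′< ⊕ slack (j′ + n))
        (solve (i ∷ j ∷ i′ ∷ j′ ∷ n ∷ k ∷ s ∷ []))

    around-straight : i′ + (n + k) ≡ i + s → j′ ≡ j + s → Arc n k i j → Arc n k i′ j′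
    around-straight e f (ahead p q) =
      absurd (p ⊕ ≤-reflexive e ⊕ ≤-reflexive (sym f) ⊕ j′< ⊕ slack i′)
        (solve (i ∷ j ∷ i′ ∷ j′ ∷ n ∷ k ∷ s ∷ []))
    around-straight e f (wrap p) = ahead
      (by (≤-reflexive e ⊕ ≤-reflexive (sym f) ⊕ i< ⊕ slack (j + 1))
          (solve (i ∷ j ∷ i′ ∷ j′ ∷ n ∷ k ∷ s ∷ [])))
      (by (p ⊕ ≤-reflexive f ⊕ ≤-reflexive (sym e)) (solve (i ∷ j ∷ i′ ∷ j′ ∷ n ∷ k ∷ s ∷ [])))

    go : Turn (n + k) s i i′ → Turn (n + k) s j j′ → Arc n k i j → Arc n k i′ j′
    go (straight e) (straight f) = straight-straight e f
    go (straight e) (around f)   = straight-around e f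
    go (around e)   (straight f) = around-straight e f
    go (around e)   (around f)   = around-around e f

  -- If j is s ≤ k steps after i, then i + k is k - s steps after j.
  arc-dual : ∀ {i j i′} → i < n + k → i′ < n + k → Turn (n + k) k i i′ → Arc n k i j → Arc n k j i′
  arc-dual {i} {j} i< i′< (straight refl) (ahead p q) = ahead q (+-monoˡ-≤ k p)
  arc-dual {i} {j} i< i′< (straight refl) (wrap p) =
    absurd (p ⊕ i′< ⊕ slack j) (solve (i ∷ j ∷ n ∷ k ∷ []))
  arc-dual {i} {j} {i′} i< i′< (around e) (ahead p q) =
    wrap (by (p ⊕ ≤-reflexive e) (solve (i ∷ j ∷ i′ ∷ n ∷ k ∷ [])))
  arc-dual {i} {j} {i′} i< i′< (around e) (wrap p) = ahead
    (by (p ⊕ ≤-reflexive (sym e)) (solve (i ∷ j ∷ i′ ∷ n ∷ k ∷ [])))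
    (by (≤-reflexive e ⊕ i< ⊕ slack (j + 1)) (solve (i ∷ j ∷ i′ ∷ n ∷ k ∷ [])))

  arc-undual : ∀ {i j i′} → j < n + k → Turn (n + k) k i i′ → Arc n k j i′ → Arc n k i j
  arc-undual {i} {j} j< (straight refl) (ahead p q) = ahead (+-cancelʳ-≤ k i j q) p
  arc-undual {i} {j} j< (straight refl) (wrap p) =
    absurd (p ⊕ j< ⊕ slack i) (solve (i ∷ j ∷ n ∷ k ∷ []))
  arc-undual {i} {j} {i′} j< (around e) (ahead p q) =
    wrap (by (p ⊕ ≤-reflexive e) (solve (i ∷ j ∷ i′ ∷ n ∷ k ∷ [])))
  arc-undual {i} {j} {i′} j< (around e) (wrap p) = ahead
    (by (p ⊕ ≤-reflexive (sym e)) (solve (i ∷ j ∷ i′ ∷ n ∷ k ∷ [])))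
    (by (≤-reflexive e ⊕ j< ⊕ slack (i′ + 1)) (solve (i ∷ j ∷ i′ ∷ n ∷ k ∷ [])))

record Rotation (n k : ℕ) : Set where
  field
    to        : ℕ → ℕ
    to-<      : ∀ {x} → x < n + k → to x < n + k
    arc       : ∀ {x y} → x < n + k → y < n + k → Arc n k x y → Arc n k (to x) (to y)
    arc⁻¹     : ∀ {x y} → x < n + k → y < n + k → Arc n k (to x) (to y) → Arc n k x y
    injective : ∀ {x y} → x < n + k → y < n + k → to x ≡ to y → x ≡ y

rotation-by : ∀ {n k s s′} → s + s′ ≡ n + k → Rotation n k
rotation-by {n} {k} {s} {s′} s+s′≡N = record
  { to        = turn (n + k) s
  ; to-<      = to-<
  ; arc       = λ x< y< → arc-turn x< (to-< x<) (to-< y<) turn-spec turn-spec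
  ; arc⁻¹     = λ x< y< → arc-turn (to-< x<) x< y< inverse inverse
  ; injective = λ x< y< eq → turn-functional x< y< inverse
      (subst (λ z → Turn (n + k) s′ z _) (sym eq) inverse)
  }
  where
  to-< : ∀ {x} → x < n + k → turn (n + k) s x < n + k
  to-< = turn-< (≤-trans (m≤m+n s s′) (≤-reflexive s+s′≡N))

  inverse : ∀ {x} → Turn (n + k) s′ (turn (n + k) s x) x
  inverse = turn-inverse s+s′≡N turn-spec

rotation-to : ∀ {n k c} → k < n → c < n + k → Σ (Rotation n k) λ ρ → Rotation.to ρ c ≡ k
rotation-to {n} {k} {c} k<n c< with ≤-total c k
... | inj₁ c≤k with m≤n⇒∃[o]m+o≡n c≤k
...   | s , c+s≡k with m≤n⇒∃[o]m+o≡n (≤-trans (≤-trans (m≤n+m s c) (≤-reflexive c+s≡k)) (m≤n+m k n))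
...     | s′ , eq = rotation-by eq ,
            turn-functional (turn-< (≤-trans (m≤m+n s s′) (≤-reflexive eq)) c<) (m<n+m k (≤-trans (s≤s z≤n) k<n))
              turn-spec (straight (sym c+s≡k))
rotation-to {n} {k} {c} k<n c< | inj₂ k≤c with m≤n⇒∃[o]m+o≡n k≤c
... | s′ , refl with m≤n⇒∃[o]m+o≡n (≤-trans (m≤n+m s′ k) (<⇒≤ c<))
...   | s , eq = rotation-by s+s′≡N ,
          turn-functional (turn-< (≤-trans (m≤m+n s s′) (≤-reflexive s+s′≡N)) c<) (m<n+m k (≤-trans (s≤s z≤n) k<n))
            turn-spec (around (trans (cong (k +_) (sym eq)) (sym (+-assoc k s′ s))))
  where
  s+s′≡N : s + s′ ≡ n + k
  s+s′≡N = trans (+-comm s s′) eq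

-- Arcs through a common point and chordless paths.

module _ {n k : ℕ} (k<n : k < n) where

  -- The point k serves as base point: a k-step arc through it starts at some l ≤ k and ends by 2k <
  -- n + k, so it is an ordinary interval.
  arc-to-k : ∀ {l} → l < n + k → Arc n k l k → l ≤ k
  arc-to-k l< (ahead l≤k _) = l≤k
  arc-to-k {l} l< (wrap p) = absurd (p ⊕ l<) (solve (k ∷ l ∷ n ∷ []))

  arc-linear : ∀ {l x} → l ≤ k → Arc n k l x → l ≤ x × x ≤ l + k
  arc-linear l≤k (ahead p q) = p , q
  arc-linear {l} {x} l≤k (wrap p) = absurd (p ⊕ l≤k ⊕ k<n ⊕ slack x) (solve (k ∷ l ∷ n ∷ x ∷ []))

  ¬arc-linear : ∀ {l x} → ¬ Arc n k l x → x < l ⊎ l + k < x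
  ¬arc-linear {l} {x} ¬arc with l ≤? x | x ≤? l + k
  ... | no l≰x  | _       = inj₁ (≰⇒> l≰x)
  ... | _       | no x≰   = inj₂ (≰⇒> x≰)
  ... | yes l≤x | yes x≤  = ⊥-elim (¬arc (ahead l≤x x≤))

  private
    -- Each interval misses a point that the other contains. On the left this gives x < l ≤ x′ < l′
    -- ≤ x, and the right is similar.
    same-side : ∀ {l l′ x x′} → l ≤ k → l′ ≤ k → Arc n k l x′ → Arc n k l′ x →
      x < l × x′ < l′ ⊎ l + k < x × l′ + k < x′ → ⊥
    same-side l≤k l′≤k p q (inj₁ (x<l , x′<l′)) =
      <-irrefl refl (<-≤-trans x<l (≤-trans (proj₁ (arc-linear l≤k p))
        (≤-trans (<⇒≤ x′<l′) (proj₁ (arc-linear l′≤k q)))))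
    same-side l≤k l′≤k p q (inj₂ (l<x , l′<x′)) =
      <-irrefl refl (<-≤-trans l<x (≤-trans (proj₂ (arc-linear l′≤k q))
        (≤-trans (<⇒≤ l′<x′) (proj₂ (arc-linear l≤k p)))))

    -- Each interval misses exactly one of the three points; by pigeonhole two of them miss theirs
    -- on the same side.
    chordless-at-k : ∀ {l₁ l₂ l₃ r₂ r₃ r₄} → l₁ ≤ k → l₂ ≤ k → l₃ ≤ k →
      ¬ Arc n k l₁ r₂ → Arc n k l₂ r₂ → Arc n k l₃ r₂ →
      Arc n k l₁ r₃ → ¬ Arc n k l₂ r₃ → Arc n k l₃ r₃ →
      Arc n k l₁ r₄ → Arc n k l₂ r₄ → ¬ Arc n k l₃ r₄ → ⊥
    chordless-at-k l₁≤ l₂≤ l₃≤ ¬c12 c22 c32 c13 ¬c23 c33 c14 c24 ¬c34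
      with ¬arc-linear ¬c12 | ¬arc-linear ¬c23 | ¬arc-linear ¬c34
    ... | inj₁ a | inj₁ b | _      = same-side l₁≤ l₂≤ c13 c22 (inj₁ (a , b))
    ... | inj₁ a | inj₂ _ | inj₁ c = same-side l₁≤ l₃≤ c14 c32 (inj₁ (a , c))
    ... | inj₁ _ | inj₂ b | inj₂ c = same-side l₂≤ l₃≤ c24 c33 (inj₂ (b , c))
    ... | inj₂ _ | inj₁ b | inj₁ c = same-side l₂≤ l₃≤ c24 c33 (inj₁ (b , c))
    ... | inj₂ a | inj₁ _ | inj₂ c = same-side l₁≤ l₃≤ c14 c32 (inj₂ (a , c))
    ... | inj₂ a | inj₂ b | _      = same-side l₁≤ l₂≤ c13 c22 (inj₂ (a , b))

  -- The path is 1 → 2 → 3 → r₄. All three arcs contain r₁, and rotating r₁ to k makes them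
  -- intervals.
  chordless-path : ∀ {l₁ l₂ l₃ r₁ r₂ r₃ r₄} →
    l₁ < n + k → l₂ < n + k → l₃ < n + k → r₁ < n + k → r₂ < n + k → r₃ < n + k → r₄ < n + k →
    Arc n k l₁ r₁ → Arc n k l₂ r₁ → Arc n k l₃ r₁ →
    ¬ Arc n k l₁ r₂ → Arc n k l₂ r₂ → Arc n k l₃ r₂ →
    Arc n k l₁ r₃ → ¬ Arc n k l₂ r₃ → Arc n k l₃ r₃ →
    Arc n k l₁ r₄ → Arc n k l₂ r₄ → ¬ Arc n k l₃ r₄ → ⊥
  chordless-path l₁< l₂< l₃< r₁< r₂< r₃< r₄< c11 c21 c31 ¬c12 c22 c32 c13 ¬c23 c33 c14 c24 ¬c34
    with rotation-to k<n r₁<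
  ... | ρ , r₁↦k = chordless-at-k (below l₁< c11) (below l₂< c21) (below l₃< c31)
      (λ p → ¬c12 (arc⁻¹ l₁< r₂< p)) (arc l₂< r₂< c22) (arc l₃< r₂< c32)
      (arc l₁< r₃< c13) (λ p → ¬c23 (arc⁻¹ l₂< r₃< p)) (arc l₃< r₃< c33)
      (arc l₁< r₄< c14) (arc l₂< r₄< c24) (λ p → ¬c34 (arc⁻¹ l₃< r₄< p))
    where
    open Rotation ρ
    below : ∀ {l} → l < n + k → Arc n k l _ → to l ≤ k
    below l< p = arc-to-k (to-< l<) (subst (Arc n k _) r₁↦k (arc l< r₁< p))

  -- The shape of a 3-cycle and the zones it cuts out.

  -- The relative position of the arcs x, y, z when y ends at k.
  record Frame (lx rx ly lz rz : ℕ) : Set where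
    field
      lx≤rx : lx ≤ rx
      rx<ly : rx < ly
      ly≤k  : ly ≤ k
      k<lz  : k < lz
      lz≤rz : lz ≤ rz
      rz≤ly : rz ≤ ly + k
      rx≤lz : rx + n ≤ lz

  -- The k-step arcs from `lx` and `ly` contain k, hence are intervals; the first misses `rz`, the
  -- second misses `rx`. Missing on the same side is contradictory, and the two mixed cases are the
  -- two cyclic orientations. For the second one, only the facts that clash with its dual are kept.
  orientation : ∀ {lx rx ly lz rz} → lx < n + k → rx < n + k → ly < n + k → lz < n + k →
    Arc n k lx rx → Arc n k ly k → Arc n k lz rz →
    ¬ Arc n k lx rz → ¬ Arc n k lz k → ¬ Arc n k ly rx →
    Arc n k lz rx → Arc n k ly rz → Arc n k lx k →
    Frame lx rx ly lz rz ⊎ Arc n k ly lx × ¬ Arc n k rx k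
  orientation {lx} {rx} {ly} {lz} {rz} lx< rx< ly< lz< xx yy zz ¬xz ¬zy ¬yx zx yz xy
    with arc-to-k lx< xy | arc-to-k ly< yy
  ... | lx≤k | ly≤k with arc-linear lx≤k xx | arc-linear ly≤k yz | ¬arc-linear ¬xz | ¬arc-linear ¬yx
  ...   | lx≤rx , _ | ly≤rz , _ | inj₁ rz<lx | inj₁ rx<ly =
            absurd (lx≤rx ⊕ ly≤rz ⊕ rz<lx ⊕ rx<ly ⊕ slack 1) (solve (lx ∷ ly ∷ rx ∷ rz ∷ []))
  ...   | _ , rx≤ | _ , rz≤ | inj₂ <rz | inj₂ <rx =
            absurd (rx≤ ⊕ rz≤ ⊕ <rz ⊕ <rx ⊕ slack 1) (solve (k ∷ lx ∷ ly ∷ rx ∷ rz ∷ []))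
  ...   | _ | ly≤rz , _ | inj₁ rz<lx | inj₂ <rx = inj₂
            ( ahead (≤-trans ly≤rz (<⇒≤ rz<lx)) (≤-trans lx≤k (m≤n+m k ly))
            , λ { (ahead rx≤k _) → absurd (rx≤k ⊕ <rx ⊕ slack ly) (solve (k ∷ ly ∷ rx ∷ []))
                ; (wrap p) → absurd (p ⊕ rx<) (solve (k ∷ n ∷ rx ∷ [])) } )
  ...   | lx≤rx , _ | _ , rz≤ | inj₂ <rz | inj₁ rx<ly = inj₁ (record
            { lx≤rx = lx≤rx ; rx<ly = rx<ly ; ly≤k = ly≤k ; k<lz = k<lz
            ; lz≤rz = unwrap zz ; rz≤ly = rz≤ ; rx≤lz = wrapped zx })
    where
    k<lz : k < lz
    k<lz = ≰⇒> λ lz≤k → ¬zy (ahead lz≤k (m≤n+m k lz))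
    unwrap : Arc n k lz rz → lz ≤ rz
    unwrap (ahead p _) = p
    unwrap (wrap p) = absurd (p ⊕ lz< ⊕ <rz ⊕ slack (1 + lx)) (solve (k ∷ lx ∷ lz ∷ n ∷ rz ∷ []))
    wrapped : Arc n k lz rx → rx + n ≤ lz
    wrapped (ahead p _) = absurd (p ⊕ rx<ly ⊕ ly≤k ⊕ k<lz ⊕ slack 1) (solve (k ∷ ly ∷ lz ∷ rx ∷ []))
    wrapped (wrap p) = p

  -- An arc past the origin would need `ly` ≤ r to meet y, and then cannot meet z. Otherwise, for l
  -- ≤ k meeting z decides between X and Y, and for l > k meeting x decides between Y and Z.
  classify : ∀ {lx rx ly lz rz l r} → Frame lx rx ly lz rz → l < n + k → Arc n k l r →
    Arc n k l rx ⊎ Arc n k lx r → Arc n k l k ⊎ Arc n k ly r → Arc n k l rz ⊎ Arc n k lz r →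
    l ≤ r × Zone n k rx rz l r
  classify {lx} {rx} {ly} {lz} {rz} {l} {r} frame l< (wrap r≤l) _ y? z? = ⊥-elim (clash z?)
    where
    open Frame frame
    meets-y : Arc n k l k ⊎ Arc n k ly r → ly ≤ r
    meets-y (inj₁ (ahead p _)) = absurd (r≤l ⊕ p ⊕ k<n ⊕ slack r) (solve (k ∷ l ∷ n ∷ r ∷ []))
    meets-y (inj₁ (wrap p))    = absurd (p ⊕ l<) (solve (k ∷ l ∷ n ∷ []))
    meets-y (inj₂ (ahead p _)) = p
    meets-y (inj₂ (wrap p))    = absurd (p ⊕ ly≤k ⊕ k<n ⊕ slack r) (solve (k ∷ ly ∷ n ∷ r ∷ []))
    ly≤r : ly ≤ r
    ly≤r = meets-y y?
    clash : Arc n k l rz ⊎ Arc n k lz r → ⊥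
    clash (inj₁ (ahead p _)) = absurd (r≤l ⊕ p ⊕ rz≤ly ⊕ ly≤r ⊕ k<n)
        (solve (k ∷ l ∷ ly ∷ n ∷ r ∷ rz ∷ []))
    clash (inj₁ (wrap p))    = absurd (p ⊕ l< ⊕ k<lz ⊕ lz≤rz ⊕ slack 1)
        (solve (k ∷ l ∷ lz ∷ n ∷ rz ∷ []))
    clash (inj₂ (ahead p _)) = absurd (p ⊕ r≤l ⊕ l< ⊕ k<lz ⊕ slack 1)
        (solve (k ∷ l ∷ lz ∷ n ∷ r ∷ []))
    clash (inj₂ (wrap p))    = absurd (p ⊕ lz≤rz ⊕ rz≤ly ⊕ ly≤r ⊕ k<n)
        (solve (k ∷ ly ∷ lz ∷ n ∷ r ∷ rz ∷ []))
  classify {lx} {rx} {ly} {lz} {rz} {l} {r} frame l< (ahead l≤r r≤l) x? y? z? = l≤r , zone (l ≤? k)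
    where
    open Frame frame
    right-of-k : k < l → Arc n k l k ⊎ Arc n k ly r → r ≤ ly + k
    right-of-k k<l (inj₁ (ahead p _)) = ⊥-elim (<⇒≱ k<l p)
    right-of-k k<l (inj₁ (wrap p))    = absurd (p ⊕ l<) (solve (k ∷ l ∷ n ∷ []))
    right-of-k k<l (inj₂ (ahead _ p)) = p
    right-of-k k<l (inj₂ (wrap p))    = absurd (p ⊕ ly≤k ⊕ k<n ⊕ slack r)
        (solve (k ∷ ly ∷ n ∷ r ∷ []))

    Y∪Z : k < l → r ≤ ly + k → Arc n k l rx ⊎ Arc n k lx r → Zone n k rx rz l r
    Y∪Z k<l r≤ly (inj₁ (ahead p _)) = absurd (p ⊕ rx<ly ⊕ ly≤k ⊕ k<l ⊕ slack 1)
        (solve (k ∷ l ∷ ly ∷ rx ∷ []))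
    Y∪Z k<l r≤ly (inj₁ (wrap p))    = Z p (by (r≤ly ⊕ ly≤k) (solve (k ∷ ly ∷ r ∷ [])))
    Y∪Z k<l r≤ly (inj₂ (ahead _ p)) = Y
      (by (rz≤ly ⊕ ly≤k ⊕ k<l ⊕ slack 1) (solve (k ∷ l ∷ ly ∷ rz ∷ [])))
      (by (p ⊕ lx≤rx) (solve (k ∷ lx ∷ r ∷ rx ∷ [])))
    Y∪Z k<l r≤ly (inj₂ (wrap p))    = absurd (p ⊕ lx≤rx ⊕ rx<ly ⊕ ly≤k ⊕ k<n ⊕ slack (1 + r))
        (solve (k ∷ lx ∷ ly ∷ n ∷ r ∷ rx ∷ []))

    not-around-z : l ≤ k → lz ≤ r → Arc n k l rx ⊎ Arc n k lx r → ⊥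
    not-around-z l≤k lz≤r (inj₁ (ahead p _)) = absurd (p ⊕ r≤l ⊕ rx≤lz ⊕ lz≤r ⊕ k<n)
        (solve (k ∷ l ∷ lz ∷ n ∷ r ∷ rx ∷ []))
    not-around-z l≤k lz≤r (inj₁ (wrap p))    = absurd (p ⊕ l≤k ⊕ k<n ⊕ slack rx)
        (solve (k ∷ l ∷ n ∷ rx ∷ []))
    not-around-z l≤k lz≤r (inj₂ (ahead _ p)) = absurd (p ⊕ lx≤rx ⊕ rx≤lz ⊕ lz≤r ⊕ k<n)
        (solve (k ∷ lx ∷ lz ∷ n ∷ r ∷ rx ∷ []))
    not-around-z l≤k lz≤r (inj₂ (wrap p))    = absurd (p ⊕ lx≤rx ⊕ rx<ly ⊕ ly≤k ⊕ k<n ⊕ slack (1 + r))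
        (solve (k ∷ lx ∷ ly ∷ n ∷ r ∷ rx ∷ []))

    around-y : l ≤ k → rz ≤ l + k → Arc n k l rx ⊎ Arc n k lx r → r ≤ rx + k
    around-y l≤k rz≤l (inj₁ (ahead p _)) = absurd (p ⊕ rz≤l ⊕ rx≤lz ⊕ lz≤rz ⊕ k<n)
        (solve (k ∷ l ∷ lz ∷ n ∷ rx ∷ rz ∷ []))
    around-y l≤k rz≤l (inj₁ (wrap p))    = absurd (p ⊕ l≤k ⊕ k<n ⊕ slack rx)
        (solve (k ∷ l ∷ n ∷ rx ∷ []))
    around-y l≤k rz≤l (inj₂ (ahead _ p)) = by (p ⊕ lx≤rx) (solve (k ∷ lx ∷ r ∷ rx ∷ []))
    around-y l≤k rz≤l (inj₂ (wrap p))    = absurd (p ⊕ lx≤rx ⊕ rx<ly ⊕ ly≤k ⊕ k<n ⊕ slack (1 + r))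
        (solve (k ∷ lx ∷ ly ∷ n ∷ r ∷ rx ∷ []))

    X∪Y : l ≤ k → Arc n k l rz ⊎ Arc n k lz r → Zone n k rx rz l r
    X∪Y l≤k (inj₁ (ahead _ p)) = Y p (around-y l≤k p x?)
    X∪Y l≤k (inj₁ (wrap p))    = absurd (p ⊕ l≤k ⊕ k<n ⊕ slack rz) (solve (k ∷ l ∷ n ∷ rz ∷ []))
    X∪Y l≤k (inj₂ (ahead p _)) = ⊥-elim (not-around-z l≤k p x?)
    X∪Y l≤k (inj₂ (wrap p))    = X (≤-trans p lz≤rz)

    zone : Dec (l ≤ k) → Zone n k rx rz l r
    zone (yes l≤k) = X∪Y l≤k z?
    zone (no l≰k)  = Y∪Z (≰⇒> l≰k) (right-of-k (≰⇒> l≰k) y?) x?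

  -- The critical case is l′ ≤ r. Then the second arc lies in the same zone as the first or an
  -- earlier one, and the zones are narrow enough for r′ ≤ l + k.
  zone-compatible : ∀ {a b l r l′ r′} → a + n ≤ b → b ≤ k + k → Zone n k a b l r → Zone n k a b l′ r′ →
    Arc n k l r′ ⊎ Arc n k l′ r → r′ ≤ l + k ⊎ r + n ≤ l′
  zone-compatible _ _ _ _ (inj₁ (ahead _ p)) = inj₁ p
  zone-compatible {l =
      l} {r′ = r′} _ _ _ _ (inj₁ (wrap p)) = inj₁ (≤-trans (m≤m+n r′ n) (≤-trans p (m≤m+n l k)))
  zone-compatible _ _ _ _ (inj₂ (wrap p)) = inj₂ p
  zone-compatible {a} {b} {l} {r} {l′} {r′} ab b≤ z z′ (inj₂ (ahead p _)) = inj₁ (go z z′)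
    where
    go : Zone n k a b l r → Zone n k a b l′ r′ → r′ ≤ l + k
    go _ (X q) = by (q ⊕ b≤ ⊕ k<n ⊕ slack (1 + l)) (solve (b ∷ k ∷ l ∷ n ∷ r′ ∷ []))
    go (X q) (Y q′ _) = absurd (q ⊕ q′ ⊕ p ⊕ k<n) (solve (b ∷ k ∷ l′ ∷ n ∷ r ∷ []))
    go (X q) (Z q′ _) = absurd (q ⊕ b≤ ⊕ q′ ⊕ p ⊕ k<n ⊕ k<n ⊕ slack (1 + a))
        (solve (a ∷ b ∷ k ∷ l′ ∷ n ∷ r ∷ []))
    go (Y q _) (Y _ q′) = by (q′ ⊕ ab ⊕ q ⊕ k<n ⊕ slack 1) (solve (a ∷ b ∷ k ∷ l ∷ n ∷ r′ ∷ []))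
    go (Y _ q) (Z q′ _) = absurd (q ⊕ q′ ⊕ p ⊕ k<n) (solve (a ∷ k ∷ l′ ∷ n ∷ r ∷ []))
    go (Z q _) (Y _ q′) = by (q′ ⊕ q ⊕ k<n ⊕ slack (1 + k)) (solve (a ∷ k ∷ l ∷ n ∷ r′ ∷ []))
    go (Z q _) (Z _ q′) = by (q′ ⊕ q ⊕ k<n ⊕ slack (1 + a)) (solve (a ∷ k ∷ l ∷ n ∷ r′ ∷ []))

-- Families of pairwise meeting arcs and the bound in the presence of a 3-cycle.

-- The member i stands for the pair of a at index L i and b at index R i.
record Family (n k m : ℕ) : Set where
  field
    L R      : Fin m → ℕ
    L<       : ∀ i → L i < n + k
    R<       : ∀ i → R i < n + k
    meet     : ∀ i j → Arc n k (L i) (R j) ⊎ Arc n k (L j) (R i)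
    distinct : ∀ i j → L i ≡ L j → R i ≡ R j → i ≡ j

  own : ∀ i → Arc n k (L i) (R i)
  own i with meet i i
  ... | inj₁ p = p
  ... | inj₂ p = p

  meet-back : ∀ {i j} → ¬ Arc n k (L i) (R j) → Arc n k (L j) (R i)
  meet-back {i} {j} ¬p with meet i j
  ... | inj₁ p = ⊥-elim (¬p p)
  ... | inj₂ p = p

record Cycle {n k m : ℕ} (F : Family n k m) : Set where
  open Family F
  field
    {x z y} : Fin m
    x→z : ¬ Arc n k (L x) (R z)
    z→y : ¬ Arc n k (L z) (R y)
    y→x : ¬ Arc n k (L y) (R x)

module _ {n k m : ℕ} (F : Family n k m) where
  open Family F

  module _ (ρ : Rotation n k) where
    open Rotation ρ

    rotate : Family n k m
    rotate = record
      { L = λ i → to (L i) ; R = λ i → to (R i)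
      ; L< = λ i → to-< (L< i) ; R< = λ i → to-< (R< i)
      ; meet = meet′
      ; distinct = λ i j l≡ r≡ → distinct i j (injective (L< i) (L< j) l≡) (injective (R< i) (R< j) r≡) }
      where
      meet′ : ∀ i j → Arc n k (to (L i)) (to (R j)) ⊎ Arc n k (to (L j)) (to (R i))
      meet′ i j with meet i j
      ... | inj₁ p = inj₁ (arc (L< i) (R< j) p)
      ... | inj₂ p = inj₂ (arc (L< j) (R< i) p)

    rotate-cycle : Cycle F → Cycle rotate
    rotate-cycle C = record
      { x→z = λ p → x→z (arc⁻¹ (L< _) (R< _) p)
      ; z→y = λ p → z→y (arc⁻¹ (L< _) (R< _) p)
      ; y→x = λ p → y→x (arc⁻¹ (L< _) (R< _) p) }
      where open Cycle C

  private
    shift : Rotation n k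
    shift = rotation-by {s = k} {n} (+-comm k n)
    module shift = Rotation shift

  dual : Family n k m
  dual = record
    { L = R ; R = λ i → shift.to (L i)
    ; L< = R< ; R< = λ i → shift.to-< (L< i)
    ; meet = meet′
    ; distinct = λ i j r≡ l≡ → distinct i j (shift.injective (L< i) (L< j) l≡) r≡ }
    where
    meet′ : ∀ i j → Arc n k (R i) (shift.to (L j)) ⊎ Arc n k (R j) (shift.to (L i))
    meet′ i j with meet i j
    ... | inj₁ p = inj₂ (arc-dual (L< i) (shift.to-< (L< i)) turn-spec p)
    ... | inj₂ p = inj₁ (arc-dual (L< j) (shift.to-< (L< j)) turn-spec p)

  -- Duality reverses every arrow, so x and y exchange roles: y → z → x → y.
  dual-cycle : Cycle F → Cycle dual
  dual-cycle C = record
    { x→z = λ p → z→y (arc-undual (R< y) turn-spec p)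
    ; z→y = λ p → x→z (arc-undual (R< z) turn-spec p)
    ; y→x = λ p → y→x (arc-undual (R< x) turn-spec p) }
    where open Cycle C

  dual-arc : ∀ {i j} → Arc n k (L i) (L j) → Arc n k (Family.R dual i) (Family.R dual j)
  dual-arc = shift.arc (L< _) (L< _)

module _ (e t : ℕ) where

  private
    k n : ℕ
    k = suc (e + t)
    n = suc (k + e)

    k<n : k < n
    k<n = s≤s (m≤m+n k e)

  frame-bound : ∀ {m} (F : Family n k m) → let open Family F in
    ∀ x y z → R y ≡ k → Frame k<n (L x) (R x) (L y) (L z) (R z) → m ≤ 3 + t + t + tri t
  -- β is `R z` - n. The frame gives `R x` + n ≤ `R z` ≤ 2k, which is a ≤ β ≤ t.
  frame-bound {m} F x y z Ry≡k frame with m≤n⇒∃[o]m+o≡n n≤Rz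
    where
    open Family F
    open Frame frame
    n≤Rz : n ≤ R z
    n≤Rz = ≤-trans (m≤n+m n (R x)) (≤-trans rx≤lz lz≤rz)
  ... | β , n+β≡Rz = Compression.zones-bound e t (R x) β a≤β β≤t L R
        (λ i → proj₁ (classified i)) zone
        (λ i j → zone-compatible k<n a+n≤b b≤2k (zone i) (zone j) (meet i j))
        distinct
    where
    open Family F
    open Frame frame

    classified : ∀ i → L i ≤ R i × Zone n k (R x) (R z) (L i) (R i)
    classified i = classify k<n frame (L< i) (own i) (meet i x)
      (subst (λ r → Arc n k (L i) r ⊎ Arc n k (L y) (R i)) Ry≡k (meet i y)) (meet i z)

    zone : ∀ i → Zone n k (R x) (n + β) (L i) (R i)
    zone i = subst (λ b → Zone n k (R x) b (L i) (R i)) (sym n+β≡Rz) (proj₂ (classified i))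

    a+n≤b : R x + n ≤ n + β
    a+n≤b = ≤-trans rx≤lz (≤-trans lz≤rz (≤-reflexive (sym n+β≡Rz)))

    b≤2k : n + β ≤ k + k
    b≤2k = ≤-trans (≤-reflexive n+β≡Rz) (≤-trans rz≤ly (+-monoˡ-≤ k ly≤k))

    a≤β : R x ≤ β
    a≤β = +-cancelʳ-≤ n (R x) β (≤-trans a+n≤b (≤-reflexive (+-comm n β)))

    β≤t : β ≤ t
    β≤t = cancel b≤2k
      where
      cancel : suc (suc (e + t) + e) + β ≤ suc (e + t) + suc (e + t) → β ≤ t
      cancel p = by p (solve (e ∷ t ∷ β ∷ []))

  -- The second alternative is the other cyclic orientation of x, y, z; duality swaps the two.
  normalise : ∀ {m} (F : Family n k m) (C : Cycle F) →
    m ≤ 3 + t + t + tri t ⊎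
    Σ (Rotation n k) λ ρ →
      Arc n k (Rotation.to ρ (Family.L F (Cycle.y C))) (Rotation.to ρ (Family.L F (Cycle.x C))) ×
      ¬ Arc n k (Rotation.to ρ (Family.R F (Cycle.x C))) (Rotation.to ρ (Family.R F (Cycle.y C)))
  normalise F C with rotation-to k<n (Family.R< F (Cycle.y C))
  ... | ρ , Ry≡k with orientation k<n (L< x) (R< x) (L< y) (L< z)
          (own x) (subst (Arc n k (L y)) Ry≡k (own y)) (own z)
          x→z (subst (λ r → ¬ Arc n k (L z) r) Ry≡k z→y) y→x
          (meet-back x→z) (meet-back z→y) (subst (Arc n k (L x)) Ry≡k (meet-back y→x))
    where
    open Family (rotate F ρ)
    open Cycle (rotate-cycle F ρ C)
  ... | inj₁ frame = inj₁ (frame-bound (rotate F ρ) x y z Ry≡k frame)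
    where open Cycle C
  ... | inj₂ (p , ¬q) = inj₂ (ρ , p , λ q → ¬q (subst (Arc n k _) Ry≡k q))

  -- If both the family and its dual had the second orientation, `L x` would lie on the k-step arc
  -- from `L y`, but no longer after both are shifted by k.
  cycle-bound : ∀ {m} (F : Family n k m) → Cycle F → m ≤ 3 + t + t + tri t
  cycle-bound F C with normalise F C
  ... | inj₁ le = le
  ... | inj₂ (ρ , p , _) with normalise (dual F) (dual-cycle F C)
  ...   | inj₁ le = le
  ...   | inj₂ (ρ′ , _ , ¬q) = ⊥-elim (¬q (Rotation.arc ρ′
            (Family.R< (dual F) (Cycle.y C)) (Family.R< (dual F) (Cycle.x C))
            (dual-arc F (Rotation.arc⁻¹ ρ (Family.L< F (Cycle.y C)) (Family.L< F (Cycle.x C)) p))))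

-- Sizes of decidable subsets.

module _ {m : ℕ} where

  comprehension : {P : Fin m → Set} → Decidable P → Subset m
  comprehension P? = tabulate (λ i → does (P? i))

  ∈-comprehension⁺ : ∀ {P : Fin m → Set} (P? : Decidable P) {i} → P i → i ∈ˢ comprehension P?
  ∈-comprehension⁺ P? {i} p = lookup⇒[]= i _ (trans (lookup∘tabulate _ i) (dec-true (P? i) p))

  ∈-comprehension⁻ : ∀ {P : Fin m → Set} (P? : Decidable P) {i} → i ∈ˢ comprehension P? → P i
  ∈-comprehension⁻ P? {i} i∈ with P? i | trans (sym (lookup∘tabulate (λ i → does (P? i)) i)) ([]=⇒lookup i∈)
  ... | yes p | _  = p
  ... | no _  | ()

  count : {P : Fin m → Set} → Decidable P → ℕ
  count P? = ∣ comprehension P? ∣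

  count-mono : ∀ {P Q : Fin m → Set} (P? : Decidable P) (Q? : Decidable Q) →
    (∀ {i} → P i → Q i) → count P? ≤ count Q?
  count-mono P? Q? P⊆Q = p⊆q⇒∣p∣≤∣q∣ λ i∈ → ∈-comprehension⁺ Q? (P⊆Q (∈-comprehension⁻ P? i∈))

  count-strict : ∀ {P Q : Fin m → Set} (P? : Decidable P) (Q? : Decidable Q) →
    (∀ {i} → P i → Q i) → ∀ i → Q i → ¬ P i → count P? < count Q?
  count-strict P? Q? P⊆Q i q ¬p = p⊂q⇒∣p∣<∣q∣
    ( (λ i∈ → ∈-comprehension⁺ Q? (P⊆Q (∈-comprehension⁻ P? i∈)))
    , i , ∈-comprehension⁺ Q? q , λ i∈ → ¬p (∈-comprehension⁻ P? i∈) )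

-- Reachability in a family without 3-cycles.

module _ {n k m : ℕ} (F : Family n k m) where
  open Family F

  cycle? : Dec (Cycle F)
  cycle? with any? (λ x → any? (λ z → any? (λ y →
    ¬? (arc? n k (L x) (R z)) ×-dec ¬? (arc? n k (L z) (R y)) ×-dec ¬? (arc? n k (L y) (R x)))))
  ... | yes (x , z , y , p , q , r) = yes (record { x→z = p ; z→y = q ; y→x = r })
  ... | no ¬c = no λ C → let open Cycle C in ¬c (x , z , y , x→z , z→y , y→x)

  -- a_i lies below b in the transitive closure of the crown order and the reversed pairs;
  -- longer chains reduce to these by reach-step.
  ReachB : ℕ → Fin m → Set
  ReachB b i = ¬ Arc n k (L i) b ⊎ ∃[ q ] ¬ Arc n k (L i) (R q) × ¬ Arc n k (L q) b

  reachB? : ∀ b → Decidable (ReachB b)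
  reachB? b i = ¬? (arc? n k (L i) b) ⊎-dec
    any? (λ q → ¬? (arc? n k (L i) (R q)) ×-dec ¬? (arc? n k (L q) b))

  -- Weakly below a in the same closure: a proper descent from a starts with a reversed pair q,
  -- which puts b_q below a_q = a.
  ReachA : ℕ → Fin m → Set
  ReachA a i = L i ≡ a ⊎ ∃[ q ] L q ≡ a × ReachB (R q) i

  reachA? : ∀ a → Decidable (ReachA a)
  reachA? a i = (L i ≟ a) ⊎-dec any? (λ q → (L q ≟ a) ×-dec reachB? (R q) i)

  -- A counterexample would be a loop or a 2-cycle of →, and `meet` excludes both.
  reach-irreflexive : ∀ i → ¬ ReachB (R i) i
  reach-irreflexive i (inj₁ ¬p)           = ¬p (own i)
  reach-irreflexive i (inj₂ (q , ¬p , ¬q)) = ¬q (meet-back ¬p)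

  module _ (k<n : k < n) (acyclic : ¬ Cycle F) where

    -- A chord i → b, i → q or j → b shortens the path i → j → q → b, and q → i closes a 3-cycle.
    -- Without any of these, `chordless-path` applies with `R i` as the common point.
    reach-step : ∀ {i q b} → b < n + k → ReachB (R q) i → ¬ Arc n k (L q) b → ReachB b i
    reach-step {i} {q} b< (inj₁ i→q) q→b = inj₂ (q , i→q , q→b)
    reach-step {i} {q} {b} b< (inj₂ (j , i→j , j→q)) q→b
      with arc? n k (L i) b | arc? n k (L i) (R q) | arc? n k (L j) b | arc? n k (L q) (R i)
    ... | no i→b | _      | _      | _      = inj₁ i→b
    ... | _      | no i→q | _      | _      = inj₂ (q , i→q , q→b)
    ... | _      | _      | no j→b | _      = inj₂ (j , i→j , j→b)
    ... | _      | _      | _      | no q→i =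
        ⊥-elim (acyclic (record { x→z = i→j ; z→y = j→q ; y→x = q→i }))
    ... | yes ib | yes iq | yes jb | yes qi = ⊥-elim (chordless-path k<n
            (L< i) (L< j) (L< q) (R< i) (R< j) (R< q) b<
            (own i) (meet-back i→j) qi
            i→j (own j) (meet-back j→q)
            iq j→q (own q)
            ib jb q→b)

    reachA⇒reachB : ∀ {a b i} → b < n + k → ¬ Arc n k a b → ReachA a i → ReachB b i
    reachA⇒reachB b< a→b (inj₁ refl)           = inj₁ a→b
    reachA⇒reachB b< a→b (inj₂ (q , refl , r)) = reach-step b< r a→b

level-mono : ∀ {N p q a b} → p < q → a < N → p * N + a < q * N + b
level-mono {N} {p} {q} {a} {b} p<q a<N = begin-strict
  p * N + a <⟨ +-monoʳ-< (p * N) a<N ⟩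
  p * N + N ≡⟨ +-comm (p * N) N ⟩
  suc p * N ≤⟨ *-monoˡ-≤ N p<q ⟩
  q * N     ≤⟨ m≤m+n (q * N) b ⟩
  q * N + b ∎
  where open ≤-Reasoning

level-injective : ∀ {N p q a b} → a < N → b < N → p * N + a ≡ q * N + b → p ≡ q × a ≡ b
level-injective {N} {p} {q} {a} {b} a<N b<N eq with <-cmp p q
... | tri< p<q _ _  = ⊥-elim (<-irrefl eq (level-mono p<q a<N))
... | tri≈ _ refl _ = refl , +-cancelˡ-≡ (p * N) a b eq
... | tri> _ _ q<p  = ⊥-elim (<-irrefl (sym eq) (level-mono q<p b<N))

-- From pairs of the crown to arcs, and the linear extension.

module _ {n k : ℕ} where

  Inc⇒Arc : ∀ {i j} → Inc n k i j → Arc n k (toℕ i) (toℕ j)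
  Inc⇒Arc (inj₁ (p , q)) = ahead p q
  Inc⇒Arc {i} {j} (inj₂ p) =
      wrap (+-cancelʳ-≤ k _ _ (≤-trans (≤-reflexive (+-assoc (toℕ j) n k)) p))

  Arc⇒Inc : ∀ {i j} → Arc n k (toℕ i) (toℕ j) → Inc n k i j
  Arc⇒Inc (ahead p q) = inj₁ (p , q)
  Arc⇒Inc {i} {j} (wrap p) =
      inj₂ (≤-trans (≤-reflexive (sym (+-assoc (toℕ j) n k))) (+-monoˡ-≤ k p))

unique-lookup-injective : ∀ {A : Set} {xs : List A} → Unique xs →
  ∀ i j → lookup xs i ≡ lookup xs j → i ≡ j
unique-lookup-injective (_ AllPairs.∷ _) Fin.zero Fin.zero _ = refl
unique-lookup-injective (x∉ AllPairs.∷ _) Fin.zero (Fin.suc j) eq =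
  ⊥-elim (All.lookup x∉ (∈-lookup j) eq)
unique-lookup-injective (x∉ AllPairs.∷ _) (Fin.suc i) Fin.zero eq =
  ⊥-elim (All.lookup x∉ (∈-lookup i) (sym eq))
unique-lookup-injective (_ AllPairs.∷ u) (Fin.suc i) (Fin.suc j) eq =
  cong Fin.suc (unique-lookup-injective u i j eq)

module _ (n k : ℕ) (S : List (Pair n k)) (unique : Unique S) (independent : Independent n k S) where

  family : Family n k (length S)
  family = record
    { L = left ; R = right
    ; L< = λ i → toℕ<n _ ; R< = λ i → toℕ<n _
    ; meet = meet
    ; distinct = λ i j l≡ r≡ → unique-lookup-injective unique i j
        (×-≡,≡→≡ (toℕ-injective l≡ , toℕ-injective r≡)) }
    where
    left right : Fin (length S) → ℕ
    left i  = toℕ (proj₁ (lookup S i))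
    right i = toℕ (proj₂ (lookup S i))

    meet : ∀ i j → Arc n k (left i) (right j) ⊎ Arc n k (left j) (right i)
    meet i j with arc? n k (left i) (right j) | arc? n k (left j) (right i)
    ... | yes p | _     = inj₁ p
    ... | _     | yes p = inj₂ p
    ... | no ¬p | no ¬q =
        ⊥-elim (independent (∈-lookup i) (∈-lookup j) (¬p ∘ Inc⇒Arc , ¬q ∘ Inc⇒Arc))

  -- Elements are ranked by how many members lie below them. For a < b the inclusion of these sets
  -- may be an equality, so levels of b are odd and those of a even. For a reversed pair it is
  -- strict, as i itself is gained, and doubling makes this outweigh the odd offset.
  acyclic⇒reversible : k < n → ¬ Cycle family → Reversible n k S
  acyclic⇒reversible k<n acyclic = position , (position-injective , position-mono) ,
    All.tabulate λ {p} p∈S → subst (Reversed n k position) (sym (lookup-index p∈S)) (reversed (index p∈S))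
    where
    open Family family

    level : Elem n k → ℕ
    level (inj₁ a) = 2 * count (reachA? family (toℕ a))
    level (inj₂ b) = suc (2 * count (reachB? family (toℕ b)))

    index-of : Elem n k → ℕ
    index-of (inj₁ a) = toℕ a
    index-of (inj₂ b) = toℕ b

    index-of-< : ∀ p → index-of p < n + k
    index-of-< (inj₁ a) = toℕ<n a
    index-of-< (inj₂ b) = toℕ<n b

    -- The index, being below n + k, only breaks ties within a level.
    position : Elem n k → ℕ
    position p = level p * (n + k) + index-of p

    position-injective : Injective _≡_ _≡_ position
    position-injective {p} {q} eq = split p q (level-injective (index-of-< p) (index-of-< q) eq)
      where
      split : ∀ p q → level p ≡ level q × index-of p ≡ index-of q → p ≡ q
      split (inj₁ a) (inj₁ b) (_ , eq) = cong inj₁ (toℕ-injective eq)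
      split (inj₂ a) (inj₂ b) (_ , eq) = cong inj₂ (toℕ-injective eq)
      split (inj₁ a) (inj₂ b) (eq , _) =
          ⊥-elim (even≢odd (count (reachA? family (toℕ a))) (count (reachB? family (toℕ b))) eq)
      split (inj₂ a) (inj₁ b) (eq , _) =
          ⊥-elim (even≢odd (count (reachA? family (toℕ b))) (count (reachB? family (toℕ a))) (sym eq))

    position-mono : ∀ p q → CrownLt n k p q → position p < position q
    position-mono (inj₁ a) (inj₂ b) a<b = level-mono
      (s≤s (*-monoʳ-≤ 2 (count-mono (reachA? family (toℕ a)) (reachB? family (toℕ b))
        (reachA⇒reachB family k<n acyclic (toℕ<n b) (a<b ∘ Arc⇒Inc)))))
      (toℕ<n a)

    reversed : ∀ i → Reversed n k position (lookup S i)
    reversed i = level-mono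
      (≤-trans (≤-reflexive (sym (*-suc 2 (count (reachB? family (R i))))))
        (*-monoʳ-≤ 2 (count-strict (reachB? family (R i)) (reachA? family (L i))
          (λ r → inj₂ (i , refl , r)) i (inj₁ refl) (reach-irreflexive family i))))
      (toℕ<n (proj₂ (lookup S i)))

-- The numerical form of the bound.

tri-double : ∀ t → tri (suc t) * 2 ≡ suc t * t
tri-double zero    = refl
tri-double (suc t) = begin
  (suc t + tri (suc t)) * 2       ≡⟨ *-distribʳ-+ 2 (suc t) (tri (suc t)) ⟩
  suc t * 2 + tri (suc t) * 2     ≡⟨ cong (suc t * 2 +_) (tri-double t) ⟩
  suc t * 2 + suc t * t           ≡⟨ *-distribˡ-+ (suc t) 2 t ⟨
  suc t * (2 + t)                 ≡⟨ *-comm (suc t) (2 + t) ⟩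
  (2 + t) * suc t                 ∎
  where open ≡-Reasoning

cyclic-family-bound : ∀ {n k m} → k < n → n ≤ 2 * k → (F : Family n k m) → Cycle F →
  m ≤ 2 + ((2 * k + 2 ∸ n) * (2 * k + 1 ∸ n)) / 2
-- The two subtractions introduce e and t: n = k + 1 + e, and n ≤ 2k then yields k = e + 1 + t.
cyclic-family-bound {n} {k} k<n n≤2k F C with m≤n⇒∃[o]m+o≡n k<n
... | e , refl with m≤n⇒∃[o]m+o≡n (excess n≤2k)
  where
  excess : suc k + e ≤ 2 * k → suc e ≤ k
  excess p = +-cancelˡ-≤ k (suc e) k (≤-trans (≤-reflexive (+-suc k e))
    (≤-trans p (≤-reflexive (cong (k +_) (+-identityʳ k)))))
...   | t , refl = ≤-trans (cycle-bound e t F C) (≤-reflexive (sym bound≡))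
  where
  x : ℕ
  x = suc e + t

  difference : ∀ c → 2 * x + c ∸ (suc x + e) ≡ c + t
  difference c = begin
    2 * x + c ∸ (suc x + e)           ≡⟨ cong (λ y → x + y + c ∸ (suc x + e)) (+-identityʳ x) ⟩
    x + x + c ∸ (suc x + e)           ≡⟨ cong (λ y → y + c ∸ (suc x + e)) (+-assoc x (suc e) t) ⟨
    x + suc e + t + c ∸ (suc x + e)   ≡⟨ cong (_∸ (suc x + e)) (+-assoc (x + suc e) t c) ⟩
    x + suc e + (t + c) ∸ (suc x + e) ≡⟨ cong₂ (λ y z → y + z ∸ (suc x + e)) (+-suc x e) (+-comm t c) ⟩
    suc x + e + (c + t) ∸ (suc x + e) ≡⟨ m+n∸m≡n (suc x + e) (c + t) ⟩
    c + t                             ∎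
    where open ≡-Reasoning

  bound≡ : 2 + ((2 * x + 2 ∸ (suc x + e)) * (2 * x + 1 ∸ (suc x + e))) / 2
    ≡ 3 + t + t + tri t
  bound≡ = begin
    2 + ((2 * x + 2 ∸ (suc x + e)) * (2 * x + 1 ∸ (suc x + e))) / 2
      ≡⟨ cong (λ p → 2 + p / 2) (cong₂ _*_ (difference 2) (difference 1)) ⟩
    2 + ((2 + t) * suc t) / 2     ≡⟨ cong (λ p → 2 + p / 2) (tri-double (suc t)) ⟨
    2 + (tri (2 + t) * 2) / 2     ≡⟨ cong (2 +_) (m*n/n≡m (tri (2 + t)) 2) ⟩
    -- Unfolding `tri` twice splits off the summands t + 1 and t.
    3 + (t + (t + tri t))         ≡⟨ cong (3 +_) (+-assoc t t (tri t)) ⟨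
    3 + t + t + tri t             ∎
    where open ≡-Reasoning

theorem1p5 : (n k : ℕ) → 3 ≤ n → k < n → n ≤ 2 * k →
    (S : List (Pair n k)) → Unique S → All (IsVertex n k) S →
    Independent n k S → ¬ Reversible n k S →
    length S ≤ 2 + ((2 * k + 2 ∸ n) * (2 * k + 1 ∸ n)) / 2
theorem1p5 n k _ k<n n≤2k S unique _ independent ¬reversible with cycle? (family n k S unique independent)
... | yes C      = cyclic-family-bound k<n n≤2k (family n k S unique independent) C
... | no acyclic = ⊥-elim (¬reversible (acyclic⇒reversible n k S unique independent k<n acyclic))
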